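{- Let $\Sigma$ be a finite alphabet. For every unranked ordered $\Sigma$-labeled tree $t$ with $|t|\ge 2$, we have $|\mathrm{dag}(t)| \le \frac12 |\mathrm{hdag}(t)|^2$.
   Context: An unranked tree over $\Sigma$ is a finite rooted tree with nodes labeled in $\Sigma$ and linearly ordered children (arbitrary finite number); $|t|$ is its number of edges. $\mathrm{dag}(t)$ is the minimal dag of $t$: its nodes are the distinct subtrees of $t$, and the node of a subtree $f(s_1,\dots,s_k)$ has $k$ ordered edges to the nodes of $s_1,\dots,s_k$; $|\mathrm{dag}(t)|$ is its number of edges. The first-child/next-sibling encoding $\mathrm{fcns}$ maps a sequence of unranked trees to a binary tree (optional left and right child at each node): $\mathrm{fcns}(\varepsilon)$ is empty and $\mathrm{fcns}(t_1\cdots t_n)=f(\mathrm{fcns}(u_1\cdots u_m),\mathrm{fcns}(t_2\cdots t_n))$ when $t_1=f(u_1,\dots,u_m)$. Hybrid dag: for each distinct subtree $s=f(s_1,\dots,s_k)$ of $t$ with $k\ge1$ introduce a fresh symbol $A_s$ and the height-one tree $\rho_s=f(\alpha_1,\dots,\alpha_k)$, where $\alpha_i$ is the label of $s_i$ if $s_i$ is a single node and $\alpha_i=A_{s_i}$ otherwise. Let $\rho'_s$ be $\rho_s$ with its root additionally marked by $A_s$. $\mathrm{hdag}(t)$ is the minimal dag of the forest of binary trees $\mathrm{fcns}(\rho'_s)$ (identical subtrees anywhere in the forest merged), and $|\mathrm{hdag}(t)|$ is its number of edges, not counting edges to absent children. -}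

module Defs where

open import Data.Fin using (toℕ)
open import Data.List
  using (List; []; _∷_; [_]; _++_; map; concatMap; filter; deduplicate; length; lookup; allFin)
open import Data.List.Properties using (∷-dec)
open import Data.Nat using (ℕ; suc; _+_; _≥?_)
open import Data.Product using (_×_; _,_; uncurry)
open import Data.Tree.Binary as Binary using (leaf)
open import Data.Unit using (⊤; tt)
open import Relation.Binary.Definitions using (DecidableEquality)
open import Relation.Binary.PropositionalEquality using (_≡_; refl; cong; cong₂)
open import Relation.Nullary using (yes; no)
open import Relation.Nullary.Decidable using (map′; _×-dec_)

data Tree (A : Set) : Set where
  node : A → List (Tree A) → Tree A

label : ∀ {A} → Tree A → A
label (node a _) = a

children : ∀ {A} → Tree A → List (Tree A)
children (node _ ts) = ts

mutual
  ∣_∣ₜ : ∀ {A} → Tree A → ℕ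
  ∣ node _ ts ∣ₜ = ∣ ts ∣ₜₛ

  -- Each tree of the list also contributes the edge from its parent.
  ∣_∣ₜₛ : ∀ {A} → List (Tree A) → ℕ
  ∣ [] ∣ₜₛ     = 0
  ∣ t ∷ ts ∣ₜₛ = suc ∣ t ∣ₜ + ∣ ts ∣ₜₛ

mutual
  subtrees : ∀ {A} → Tree A → List (Tree A)
  subtrees t@(node _ ts) = t ∷ subtreesₛ ts

  subtreesₛ : ∀ {A} → List (Tree A) → List (Tree A)
  subtreesₛ []       = []
  subtreesₛ (t ∷ ts) = subtrees t ++ subtreesₛ ts

module _ {A : Set} (_≟_ : DecidableEquality A) where
  mutual
    treeDec : DecidableEquality (Tree A)
    treeDec (node a ts) (node b us) =
      map′ (uncurry (cong₂ node)) (λ { refl → refl , refl }) (a ≟ b ×-dec treesDec ts us)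

    treesDec : DecidableEquality (List (Tree A))
    treesDec []       []       = yes refl
    treesDec []       (_ ∷ _)  = no λ ()
    treesDec (_ ∷ _)  []       = no λ ()
    treesDec (t ∷ ts) (u ∷ us) = ∷-dec (treeDec t u) (treesDec ts us)

-- The leaf is the empty tree, i.e. an absent child.
BTree : Set → Set
BTree A = Binary.Tree A ⊤

-- Only the non-empty subtrees.
subtreesᵇ : ∀ {A} → BTree A → List (BTree A)
subtreesᵇ (leaf _)              = []
subtreesᵇ t@(Binary.node l _ r) = t ∷ subtreesᵇ l ++ subtreesᵇ r

btreeDec : ∀ {A} → DecidableEquality A → DecidableEquality (BTree A)
btreeDec _≟_ (leaf tt)             (leaf tt)             = yes refl
btreeDec _≟_ (leaf _)              (Binary.node _ _ _)   = no λ ()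
btreeDec _≟_ (Binary.node _ _ _)   (leaf _)              = no λ ()
btreeDec _≟_ (Binary.node l a r)   (Binary.node l′ b r′) =
  map′ (λ { (refl , refl , refl) → refl }) (λ { refl → refl , refl , refl })
       (btreeDec _≟_ l l′ ×-dec a ≟ b ×-dec btreeDec _≟_ r r′)

fcns : ∀ {A} → List (Tree A) → BTree A
fcns []               = leaf tt
fcns (node f us ∷ ts) = Binary.node (fcns us) f (fcns ts)

-- Edges carry their position among the edges leaving the source, so that
-- parallel edges are distinguished.
record Dag (N P : Set) : Set where
  field
    nodes : List N
    edges : List (N × P × N)

∣_∣ : ∀ {N P} → Dag N P → ℕ
∣ d ∣ = length (Dag.edges d)

-- `occurrences` lists, possibly with repetitions, all subtrees of a tree or
-- forest; equal ones are merged.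
minimalDag : ∀ {N P} → DecidableEquality N → (N → List (P × N)) → List N → Dag N P
minimalDag _≟_ out occurrences = record
  { nodes = distinct
  ; edges = concatMap (λ s → map (s ,_) (out s)) distinct
  }
  where distinct = deduplicate _≟_ occurrences

treeOut : ∀ {A} → Tree A → List (ℕ × Tree A)
treeOut (node _ ts) = map (λ i → toℕ i , lookup ts i) (allFin (length ts))

dag : ∀ {A} → DecidableEquality A → Tree A → Dag (Tree A) ℕ
dag _≟_ t = minimalDag (treeDec _≟_) treeOut (subtrees t)

data Side : Set where
  left right : Side

edgeTo : ∀ {A} → Side → BTree A → List (Side × BTree A)
edgeTo _ (leaf _)              = []
edgeTo d t@(Binary.node _ _ _) = [ d , t ]

btreeOut : ∀ {A} → BTree A → List (Side × BTree A)
btreeOut (leaf _)            = []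
btreeOut (Binary.node l _ r) = edgeTo left l ++ edgeTo right r

-- `nonterminal s` is A_s, and `marked f s` is the letter f marked by A_s.
data Symbol (A : Set) : Set where
  letter      : A → Symbol A
  nonterminal : Tree A → Symbol A
  marked      : A → Tree A → Symbol A

symbolDec : ∀ {A} → DecidableEquality A → DecidableEquality (Symbol A)
symbolDec _≟_ (letter a)      (letter b)      = map′ (cong letter) (λ { refl → refl }) (a ≟ b)
symbolDec _≟_ (letter _)      (nonterminal _) = no λ ()
symbolDec _≟_ (letter _)      (marked _ _)    = no λ ()
symbolDec _≟_ (nonterminal _) (letter _)      = no λ ()
symbolDec _≟_ (nonterminal s) (nonterminal t) =
  map′ (cong nonterminal) (λ { refl → refl }) (treeDec _≟_ s t)
symbolDec _≟_ (nonterminal _) (marked _ _)    = no λ ()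
symbolDec _≟_ (marked _ _)    (letter _)      = no λ ()
symbolDec _≟_ (marked _ _)    (nonterminal _) = no λ ()
symbolDec _≟_ (marked a s)    (marked b t)    =
  map′ (uncurry (cong₂ marked)) (λ { refl → refl , refl }) (a ≟ b ×-dec treeDec _≟_ s t)

α : ∀ {A} → Tree A → Symbol A
α (node a [])        = letter a
α s@(node _ (_ ∷ _)) = nonterminal s

ρ : ∀ {A} → Tree A → Tree (Symbol A)
ρ (node f ss) = node (letter f) (map (λ s → node (α s) []) ss)

ρ′ : ∀ {A} → Tree A → Tree (Symbol A)
ρ′ s = node (marked (label s) s) (children (ρ s))

module _ {A : Set} (_≟_ : DecidableEquality A) where
  distinctInternalSubtrees : Tree A → List (Tree A)
  distinctInternalSubtrees t =
    filter (λ s → length (children s) ≥? 1) (deduplicate (treeDec _≟_) (subtrees t))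

  hdagForest : Tree A → List (BTree (Symbol A))
  hdagForest t = map (λ s → fcns [ ρ′ s ]) (distinctInternalSubtrees t)

  hdag : Tree A → Dag (BTree (Symbol A)) Side
  hdag t = minimalDag (btreeDec (symbolDec _≟_)) btreeOut (concatMap subtreesᵇ (hdagForest t))

{-# OPTIONS --safe #-}
-- Let m be the number of distinct internal subtrees of t and h = |hdag(t)|.
-- Each of them contributes the left edge of its marked root, and the k children
-- of any one of them contribute k − 1 right edges, so m + k ≤ h + 1.  Summing
-- over the internal subtrees gives m² + |dag(t)| ≤ m(h + 1), and the rest is
-- (h − m)² + m² ≥ 2m.

module Submission where

open import Defs
open import Data.Fin using (Fin; _≟_)
open import Data.List
  using (List; []; _∷_; [_]; _++_; map; concatMap; filter; deduplicate; length; downFrom; allFin)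
open import Data.List.Properties
  using (length-++; length-++-sucʳ; length-map; length-tabulate)
open import Data.List.Membership.Propositional using (_∈_; lose)
open import Data.List.Membership.Propositional.Properties
  using (∈-∃++; ∈-++⁺ˡ; ∈-++⁺ʳ; ∈-++⁻; ∈-map⁺; ∈-map⁻; ∈-concatMap⁺;
         ∈-filter⁺; ∈-filter⁻; ∈-deduplicate⁺)
open import Data.List.Relation.Binary.Disjoint.Propositional using (Disjoint)
open import Data.List.Relation.Binary.Subset.Propositional using (_⊆_)
open import Data.List.Relation.Unary.All as All using ([]; _∷_)
open import Data.List.Relation.Unary.Any using (here; there)
open import Data.List.Relation.Unary.AllPairs using ([]; _∷_)
open import Data.List.Relation.Unary.Unique.Propositional using (Unique)
open import Data.List.Relation.Unary.Unique.Propositional.Properties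
  using (map⁺; map⁻; ++⁺; filter⁺; downFrom⁺)
open import Data.List.Relation.Unary.Unique.DecPropositional.Properties using (deduplicate-!)
open import Data.Nat using (ℕ; suc; _+_; _≤_; _≥_; _≥?_; _*_; _^_; z≤n; s≤s; s≤s⁻¹)
open import Data.Nat.Properties hiding (_≟_)
open import Data.Nat.Tactic.RingSolver using (solve-∀)
open import Data.Product using (_×_; _,_; proj₁; proj₂)
open import Data.Sum using (inj₁; inj₂)
open import Data.Tree.Binary as Binary using (leaf)
open import Function using (_∘_)
open import Relation.Binary.Definitions using (DecidableEquality)
open import Relation.Binary.PropositionalEquality
  using (_≡_; _≢_; refl; sym; trans; cong; cong₂; subst)
open import Relation.Nullary using (contradiction)

-- This turns a list of pairwise distinct edges or subtrees into a lower bound on a count. Induction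
-- on `xs`: cut one occurrence of `x` out of `ys`; the rest of `xs` avoids `x` and so still lies in
-- what remains.
Unique-⊆⇒length-≤ : ∀ {A : Set} {xs ys : List A} → Unique xs → xs ⊆ ys → length xs ≤ length ys
Unique-⊆⇒length-≤ {xs = []} _ _ = z≤n
Unique-⊆⇒length-≤ {xs = x ∷ xs} (x∉xs ∷ xs!) x∷xs⊆ys with ∈-∃++ (x∷xs⊆ys (here refl))
... | as , bs , refl = begin
  suc (length xs)          ≤⟨ s≤s (Unique-⊆⇒length-≤ xs! xs⊆as++bs) ⟩
  suc (length (as ++ bs))  ≡⟨ length-++-sucʳ as x bs ⟨
  length (as ++ x ∷ bs)    ∎
  where
  open ≤-Reasoning
  xs⊆as++bs : xs ⊆ as ++ bs
  xs⊆as++bs z∈xs with ∈-++⁻ as (x∷xs⊆ys (there z∈xs))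
  ... | inj₁ z∈as         = ∈-++⁺ˡ z∈as
  ... | inj₂ (here refl)  = contradiction refl (All.lookup x∉xs z∈xs)
  ... | inj₂ (there z∈bs) = ∈-++⁺ʳ as z∈bs

minimalDag-edge : ∀ {N P : Set} (_≈?_ : DecidableEquality N) (out : N → List (P × N)) {occurrences n e} →
  n ∈ occurrences → e ∈ out n → (n , e) ∈ Dag.edges (minimalDag _≈?_ out occurrences)
minimalDag-edge _≈?_ out {n = n} n∈ e∈ =
  ∈-concatMap⁺ (λ s → map (s ,_) (out s)) (lose (∈-deduplicate⁺ _≈?_ n∈) (∈-map⁺ (n ,_) e∈))

-- Right edges between consecutive siblings.

Edge : Set → Set
Edge A = BTree A × Side × BTree A

-- The first tree is a separate argument, so the encoded sequence `t ∷ us` is never empty and each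
-- target is a present child.
siblingEdges : ∀ {A} → Tree A → List (Tree A) → List (Edge A)
siblingEdges t []       = []
siblingEdges t (u ∷ us) = (fcns (t ∷ u ∷ us) , right , fcns (u ∷ us)) ∷ siblingEdges u us

-- An invariant that recovers from an encoding the number of trees encoded, and so separates the
-- sources of the sibling edges.
rightSpine : ∀ {A} → BTree A → ℕ
rightSpine (leaf _)            = 0
rightSpine (Binary.node _ _ r) = suc (rightSpine r)

rightSpine-fcns : ∀ {A} (ts : List (Tree A)) → rightSpine (fcns ts) ≡ length ts
rightSpine-fcns []              = refl
rightSpine-fcns (node _ _ ∷ ts) = cong suc (rightSpine-fcns ts)

siblingEdges-spines : ∀ {A} (t : Tree A) us →
  map (rightSpine ∘ proj₁) (siblingEdges t us) ≡ map (2 +_) (downFrom (length us))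
siblingEdges-spines t []       = refl
siblingEdges-spines t (u ∷ us) = cong₂ _∷_ (rightSpine-fcns (t ∷ u ∷ us)) (siblingEdges-spines u us)

-- Equal siblings cause no merging here: the sources have right spines of lengths `length us + 1`
-- down to 2, so they are pairwise distinct.
siblingEdges-! : ∀ {A} (t : Tree A) us → Unique (siblingEdges t us)
siblingEdges-! t us = map⁻ (subst Unique (sym (siblingEdges-spines t us))
  (map⁺ (suc-injective ∘ suc-injective) (downFrom⁺ (length us))))

length-siblingEdges : ∀ {A} (t : Tree A) us → length (siblingEdges t us) ≡ length us
length-siblingEdges t []       = refl
length-siblingEdges t (u ∷ us) = cong suc (length-siblingEdges u us)

siblingEdges-right : ∀ {A} (t : Tree A) us {e} → e ∈ siblingEdges t us → proj₁ (proj₂ e) ≡ right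
siblingEdges-right t (u ∷ us) (here refl) = refl
siblingEdges-right t (u ∷ us) (there e∈)  = siblingEdges-right u us e∈

siblingEdges-source : ∀ {A} (t : Tree A) us {e} → e ∈ siblingEdges t us →
  proj₁ e ∈ subtreesᵇ (fcns (t ∷ us))
siblingEdges-source (node _ _)  (node _ _ ∷ us) (here refl) = here refl
siblingEdges-source (node _ ts) (u ∷ us)        (there e∈)  =
  there (∈-++⁺ʳ (subtreesᵇ (fcns ts)) (siblingEdges-source u us e∈))

siblingEdges-out : ∀ {A} (t : Tree A) us {e} → e ∈ siblingEdges t us →
  proj₂ e ∈ btreeOut (proj₁ e)
siblingEdges-out (node _ ts) (node _ _ ∷ us) (here refl) =
  ∈-++⁺ʳ (edgeTo left (fcns ts)) (here refl)
siblingEdges-out t           (u ∷ us)        (there e∈)  = siblingEdges-out u us e∈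

t∈subtrees : ∀ {A} (t : Tree A) → t ∈ subtrees t
t∈subtrees (node _ _) = here refl

-- Marked roots and the lower bound on the hybrid dag.

Internal : ∀ {A} → Tree A → Set
Internal s = length (children s) ≥ 1

rootEdge : ∀ {A} → Tree A → Edge (Symbol A)
rootEdge s = fcns [ ρ′ s ] , left , fcns (children (ρ s))

-- The source alone decides: its root label `marked (label s) s` carries the whole tree `s`.
rootEdge-injective : ∀ {A} {s t : Tree A} → rootEdge s ≡ rootEdge t → s ≡ t
rootEdge-injective {s = s} {t} eq with s | t | cong proj₁ eq
... | node _ _ | node _ _ | refl = refl

rootEdge-out : ∀ {A} {s : Tree A} → Internal s → proj₂ (rootEdge s) ∈ btreeOut (fcns [ ρ′ s ])
rootEdge-out {s = node _ []}      ()
rootEdge-out {s = node _ (_ ∷ _)} _ = here refl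

module _ {A : Set} (_≈?_ : DecidableEquality A) where

  internals : Tree A → List (Tree A)
  internals = distinctInternalSubtrees _≈?_

  ∈-internals⁺ : ∀ {s} t → s ∈ subtrees t → Internal s → s ∈ internals t
  ∈-internals⁺ t s∈ = ∈-filter⁺ (λ s → length (children s) ≥? 1) (∈-deduplicate⁺ (treeDec _≈?_) s∈)

  internals-internal : ∀ {s} t → s ∈ internals t → Internal s
  internals-internal t = proj₂ ∘ ∈-filter⁻ (λ s → length (children s) ≥? 1)
    {xs = deduplicate (treeDec _≈?_) (subtrees t)}

  internals-! : ∀ t → Unique (internals t)
  internals-! t = filter⁺ _ (deduplicate-! (treeDec _≈?_) (subtrees t))

  hdag-edge : ∀ t {s n e} → s ∈ internals t → n ∈ subtreesᵇ (fcns [ ρ′ s ]) → e ∈ btreeOut n →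
    (n , e) ∈ Dag.edges (hdag _≈?_ t)
  hdag-edge t s∈ n∈ = minimalDag-edge (btreeDec (symbolDec _≈?_)) btreeOut
    (∈-concatMap⁺ subtreesᵇ (lose (∈-map⁺ (λ s → fcns [ ρ′ s ]) s∈) n∈))

  -- The roots of the ρ′ are pairwise distinct because of their marks, and the
  -- proper suffixes of one sibling list because of their lengths.
  hdag-lower-bound : ∀ t {s} → s ∈ internals t →
    length (internals t) + length (children s) ≤ suc ∣ hdag _≈?_ t ∣
  hdag-lower-bound t {node f []}       s∈ = contradiction (internals-internal t s∈) λ ()
  hdag-lower-bound t {node f (u ∷ us)} s∈ = begin
    length (internals t) + suc (length us)
      ≡⟨ +-suc (length (internals t)) (length us) ⟩
    suc (length (internals t) + length us)
      ≡⟨ cong suc (cong₂ _+_ (length-map rootEdge (internals t)) length-rights) ⟨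
    suc (length lefts + length rights)
      ≡⟨ cong suc (length-++ lefts) ⟨
    suc (length (lefts ++ rights))
      ≤⟨ s≤s (Unique-⊆⇒length-≤ unique included) ⟩
    suc ∣ hdag _≈?_ t ∣
      ∎
    where
    open ≤-Reasoning
    leafα  = λ (s : Tree A) → node (α s) []
    lefts  = map rootEdge (internals t)
    rights = siblingEdges (leafα u) (map leafα us)

    length-rights : length rights ≡ length us
    length-rights = trans (length-siblingEdges (leafα u) (map leafα us)) (length-map leafα us)

    -- The `Side` component separates the two families.
    disjoint : Disjoint lefts rights
    disjoint (e∈lefts , e∈rights)
      with ∈-map⁻ rootEdge e∈lefts | siblingEdges-right (leafα u) (map leafα us) e∈rights
    ... | _ , _ , refl | ()

    unique : Unique (lefts ++ rights)
    unique = ++⁺ (map⁺ rootEdge-injective (internals-! t)) (siblingEdges-! (leafα u) (map leafα us)) disjoint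

    included : lefts ++ rights ⊆ Dag.edges (hdag _≈?_ t)
    included e∈ with ∈-++⁻ lefts e∈
    ... | inj₁ e∈lefts with ∈-map⁻ rootEdge e∈lefts
    ...   | r , r∈ , refl = hdag-edge t r∈ (here refl) (rootEdge-out {s = r} (internals-internal t r∈))
    included e∈ | inj₂ e∈rights = hdag-edge t s∈
      -- The sibling sequence is encoded in the left subtree of the marked root.
      (there (∈-++⁺ˡ (siblingEdges-source (leafα u) (map leafα us) e∈rights)))
      (siblingEdges-out (leafα u) (map leafα us) e∈rights)

  -- Out-degrees and the edge count of the dag.

  length-treeOut : ∀ (t : Tree A) → length (treeOut t) ≡ length (children t)
  length-treeOut (node _ ts) = trans (length-map _ (allFin (length ts))) (length-tabulate {n = length ts} _)

  outEdges : Tree A → List (Tree A × ℕ × Tree A)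
  outEdges s = map (s ,_) (treeOut s)

  length-outEdges : ∀ s → length (outEdges s) ≡ length (children s)
  length-outEdges s = trans (length-map (s ,_) (treeOut s)) (length-treeOut s)

  -- Subtrees without children have no outgoing edges, so only internal ones contribute to either
  -- side. The number `m` is kept independent of `xs` so that it stays fixed during the induction.
  out-sum-bound : ∀ m h (xs : List (Tree A)) → let internal = filter (λ s → length (children s) ≥? 1) xs in
    (∀ {s} → s ∈ internal → m + length (children s) ≤ h) →
    length internal * m + length (concatMap outEdges xs) ≤ length internal * h
  out-sum-bound m h []       bound = z≤n
  out-sum-bound m h (node _ [] ∷ xs)         bound = out-sum-bound m h xs bound
  out-sum-bound m h (x@(node _ (_ ∷ _)) ∷ xs) bound = begin
    (m + l * m) + length (outEdges x ++ concatMap outEdges xs)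
      ≡⟨ cong ((m + l * m) +_) (length-++ (outEdges x)) ⟩
    (m + l * m) + (length (outEdges x) + d)
      ≡⟨ cong (λ k → (m + l * m) + (k + d)) (length-outEdges x) ⟩
    (m + l * m) + (length (children x) + d)
      ≡⟨ +-+-interchange m (l * m) (length (children x)) d ⟩
    (m + length (children x)) + (l * m + d)
      ≤⟨ +-mono-≤ (bound (here refl)) (out-sum-bound m h xs (bound ∘ there)) ⟩
    h + l * h
      ∎
    where
    open ≤-Reasoning
    l = length (filter (λ s → length (children s) ≥? 1) xs)
    d = length (concatMap outEdges xs)
    +-+-interchange : ∀ a b c d → (a + b) + (c + d) ≡ (a + c) + (b + d)
    +-+-interchange = solve-∀

  dag-upper-bound : ∀ t → let m = length (internals t) in
    m * m + ∣ dag _≈?_ t ∣ ≤ m * suc ∣ hdag _≈?_ t ∣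
  dag-upper-bound t = out-sum-bound _ _ (deduplicate (treeDec _≈?_) (subtrees t)) (hdag-lower-bound t)

  -- Side conditions for the arithmetic.

  t∈internals : ∀ t → Internal t → t ∈ internals t
  t∈internals t = ∈-internals⁺ t (t∈subtrees t)

  -- Either the root has two children, or its single child is internal and
  -- gives a second marked root.
  hdag-≥2 : ∀ t → ∣ t ∣ₜ ≥ 2 → ∣ hdag _≈?_ t ∣ ≥ 2
  hdag-≥2 t@(node f (u ∷ v ∷ us)) _ = s≤s⁻¹ (begin
    1 + 2                                       ≤⟨ +-mono-≤ 1≤internals (s≤s (s≤s z≤n)) ⟩
    length (internals t) + length (children t)  ≤⟨ hdag-lower-bound t t∈ ⟩
    suc ∣ hdag _≈?_ t ∣                         ∎)
    where
    open ≤-Reasoning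
    t∈ = t∈internals t (s≤s z≤n)
    1≤internals : 1 ≤ length (internals t)
    1≤internals = Unique-⊆⇒length-≤ {xs = [ t ]} ([] ∷ []) λ { (here refl) → t∈ }
  -- Such a tree has a single edge, which the hypothesis excludes.
  hdag-≥2 (node f (node g [] ∷ [])) (s≤s ())
  hdag-≥2 t@(node f (u@(node g (v ∷ vs)) ∷ [])) _ = s≤s⁻¹ (begin
    2 + 1                                       ≤⟨ +-monoˡ-≤ 1 2≤internals ⟩
    length (internals t) + length (children t)  ≤⟨ hdag-lower-bound t t∈ ⟩
    suc ∣ hdag _≈?_ t ∣                         ∎)
    where
    open ≤-Reasoning
    t∈ = t∈internals t (s≤s z≤n)
    u∈ = ∈-internals⁺ t (there (∈-++⁺ˡ (t∈subtrees u))) (s≤s z≤n)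
    t≢u : t ≢ u
    -- `t` has one edge more than its child `u`; the `+ 0` to be removed comes from the empty list
    -- of further siblings.
    t≢u t≡u = 1+n≢n (trans (sym (+-identityʳ (suc ∣ u ∣ₜ))) (cong ∣_∣ₜ t≡u))
    2≤internals : 2 ≤ length (internals t)
    2≤internals = Unique-⊆⇒length-≤ {xs = t ∷ u ∷ []} ((t≢u ∷ []) ∷ [] ∷ [])
      λ { (here refl) → t∈ ; (there (here refl)) → u∈ }

  -- Any one internal subtree has `k ≥ 1` children, so `m + 1 ≤ m + k ≤ h + 1`; with no internal
  -- subtree the bound is trivial.
  internals-≤-hdag : ∀ t → length (internals t) ≤ ∣ hdag _≈?_ t ∣
  internals-≤-hdag t = go (internals t) (internals-internal t) (hdag-lower-bound t)
    where
    open ≤-Reasoning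
    go : ∀ {h} ss → (∀ {s} → s ∈ ss → Internal s) →
      (∀ {s} → s ∈ ss → length ss + length (children s) ≤ suc h) → length ss ≤ h
    go     []       _        _     = z≤n
    go {h} (s ∷ ss) internal bound = s≤s⁻¹ (begin
      1 + length (s ∷ ss)                    ≡⟨ +-comm 1 _ ⟩
      length (s ∷ ss) + 1                    ≤⟨ +-monoʳ-≤ _ (internal (here refl)) ⟩
      length (s ∷ ss) + length (children s)  ≤⟨ bound (here refl) ⟩
      suc h                                  ∎)

-- Of (h − m)² + m² ≥ 2m, only the case m = 1 needs h ≥ 2.
quadratic-bound : ∀ {m h d} → m ≤ h → 2 ≤ h → m * m + d ≤ m * suc h → 2 * d ≤ h ^ 2
-- Adding `2 * (m * m)` to both sides avoids subtraction.
quadratic-bound {m} {h} {d} m≤h 2≤h le = +-cancelˡ-≤ (2 * (m * m)) _ _ (begin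
  2 * (m * m) + 2 * d  ≡⟨ *-distribˡ-+ 2 (m * m) d ⟨
  2 * (m * m + d)      ≤⟨ *-monoʳ-≤ 2 le ⟩
  2 * (m * suc h)      ≤⟨ square-gap m m≤h ⟩
  2 * (m * m) + h ^ 2  ∎)
  where
  open ≤-Reasoning
  square-gap : ∀ m → m ≤ h → 2 * (m * suc h) ≤ 2 * (m * m) + h ^ 2
  square-gap 0 _ = z≤n
  square-gap 1 _ = begin
    2 * (1 * suc h)  ≡⟨ one h ⟩
    2 + 2 * h        ≤⟨ +-monoʳ-≤ 2 (*-monoˡ-≤ h 2≤h) ⟩
    2 + h * h        ≡⟨ cong (λ x → 2 + h * x) (*-identityʳ h) ⟨
    2 + h ^ 2        ∎
    where
    one : ∀ h → 2 * (1 * suc h) ≡ 2 + 2 * h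
    one = solve-∀
  square-gap m@(suc (suc n)) m≤h with m≤n⇒∃[o]m+o≡n m≤h
  ... | q , refl = begin
    -- With `m = n + 2` and `h = m + q`, the slack `(h − m)² + m² − 2m` is exactly `q * q + n * m`.
    2 * (m * suc (m + q))                        ≤⟨ m≤m+n _ (q * q + n * m) ⟩
    2 * (m * suc (m + q)) + (q * q + n * m)      ≡⟨ many n q ⟩
    2 * (m * m) + (m + q) ^ 2                    ∎
    where
    many : ∀ n q → 2 * ((2 + n) * suc ((2 + n) + q)) + (q * q + n * (2 + n))
                 ≡ 2 * ((2 + n) * (2 + n)) + ((2 + n) + q) * (((2 + n) + q) * 1)
    many = solve-∀

theorem2 : (σ : ℕ) (t : Tree (Fin σ)) → ∣ t ∣ₜ ≥ 2 →
    2 * ∣ dag _≟_ t ∣ ≤ ∣ hdag _≟_ t ∣ ^ 2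
theorem2 σ t ∣t∣≥2 =
  quadratic-bound (internals-≤-hdag _≟_ t) (hdag-≥2 _≟_ t ∣t∣≥2) (dag-upper-bound _≟_ t)
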